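{- Let $f:A\to X$ and $g:B\to X$ be maps and $P:X\to\mathcal{U}$ a type family. Then $$\Sigma(A\ast_X B).\big(P\circ(f\ast g)\big) = \big(\Sigma A.(P\circ f)\big)\ast_{\Sigma X.P}\big(\Sigma B.(P\circ g)\big),$$ where on the right the join is taken of the maps $\Sigma A.(P\circ f)\to\Sigma X.P$, $(a,x)\mapsto(f(a),x)$ and $\Sigma B.(P\circ g)\to\Sigma X.P$, $(b,y)\mapsto (g(b),y)$.
   Context: Homotopy type theory; $\mathcal{U}$ is a universe; all (co)limits are homotopy (co)limits. Join of maps: for $f:A\to X$, $g:B\to X$, $A\times_X B=\Sigma(a:A).\Sigma(b:B).(f(a)=g(b))$, $A\ast_XB$ is the pushout of the two projections out of $A\times_XB$, and $f\ast g:A\ast_XB\to X$ is the map induced by $f$ and $g$. -}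

{-# OPTIONS --safe --without-K #-}

-- Homotopy type theory is rendered as Agda without axiom K, in which types need
-- not be sets and _≡_ is the identity type.  What K-free Agda lacks, namely
-- pushouts, function extensionality and univalence, is stated here so that
-- theorems can take it as a hypothesis.

module Defs where

open import Axiom.Extensionality.Propositional using (Extensionality)
open import Data.Product.Base using (Σ; Σ-syntax; _,_; proj₁; proj₂)
open import Function.Base using (_∘_; id)
open import Function.Properties.Inverse.HalfAdjointEquivalence using (_≃_)
open import Level using (Level; _⊔_; Setω) renaming (suc to lsuc)
open import Relation.Binary.PropositionalEquality
  using (_≡_; refl; sym; trans; cong; subst; dcong)

private
  variable
    a b c x p q ℓ : Level

FunExt : Setω
FunExt = ∀ {a b} → Extensionality a b

idEquiv : (A : Set ℓ) → A ≃ A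
idEquiv A = record
  { to               = id
  ; from             = id
  ; left-inverse-of  = λ _ → refl
  ; right-inverse-of = λ _ → refl
  ; left-right       = λ _ → refl
  }

idToEquiv : {A B : Set ℓ} → A ≡ B → A ≃ B
idToEquiv {A = A} refl = idEquiv A

-- The second component says that the equivalence is idToEquiv, so this is the
-- assertion that idToEquiv itself is an equivalence.

Univalence : (ℓ : Level) → Set (lsuc ℓ)
Univalence ℓ = (A B : Set ℓ) →
  Σ[ e ∈ ((A ≡ B) ≃ (A ≃ B)) ] (∀ r → _≃_.to e r ≡ idToEquiv r)

subst-constant : {A : Set a} {Z : Set ℓ} {y y′ : A} (r : y ≡ y′) {z : Z} →
                 subst (λ _ → Z) r z ≡ z
subst-constant refl = refl

-- W is a homotopy pushout of u and v, as a higher inductive type: point and path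
-- constructors and dependent elimination into every universe.  All computation
-- rules hold up to _≡_; the one for paths is therefore conjugated by those for
-- points.

record IsPushout {S : Set c} {A : Set a} {B : Set b}
                 (u : S → A) (v : S → B) (W : Set ℓ) : Setω where
  field
    inl  : A → W
    inr  : B → W
    glue : (s : S) → inl (u s) ≡ inr (v s)

  PathOver : (Q : W → Set q) →
             ((y : A) → Q (inl y)) → ((z : B) → Q (inr z)) → Set (c ⊔ q)
  PathOver Q l r = (s : S) → subst Q (glue s) (l (u s)) ≡ r (v s)

  field
    ind : (Q : W → Set q)
          (l : (y : A) → Q (inl y)) (r : (z : B) → Q (inr z)) →
          PathOver Q l r → (w : W) → Q w

    ind-inl : (Q : W → Set q)
              (l : (y : A) → Q (inl y)) (r : (z : B) → Q (inr z))
              (m : PathOver Q l r) →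
              (y : A) → ind Q l r m (inl y) ≡ l y

    ind-inr : (Q : W → Set q)
              (l : (y : A) → Q (inl y)) (r : (z : B) → Q (inr z))
              (m : PathOver Q l r) →
              (z : B) → ind Q l r m (inr z) ≡ r z

    ind-glue : (Q : W → Set q)
               (l : (y : A) → Q (inl y)) (r : (z : B) → Q (inr z))
               (m : PathOver Q l r) →
               (s : S) →
               dcong (ind Q l r m) (glue s) ≡
               trans (cong (subst Q (glue s)) (ind-inl Q l r m (u s)))
                     (trans (m s) (sym (ind-inr Q l r m (v s))))

  rec : {Z : Set q} (l : A → Z) (r : B → Z) →
        ((s : S) → l (u s) ≡ r (v s)) → W → Z
  rec {Z = Z} l r m =
    ind (λ _ → Z) l r (λ s → trans (subst-constant (glue s)) (m s))

record Pushouts : Setω where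
  field
    Pushout   : {S : Set c} {A : Set a} {B : Set b} →
                (S → A) → (S → B) → Set (a ⊔ b ⊔ c)
    isPushout : {S : Set c} {A : Set a} {B : Set b}
                (u : S → A) (v : S → B) → IsPushout u v (Pushout u v)

module _ (po : Pushouts) where

  open Pushouts po

  module _ {A : Set a} {B : Set b} {X : Set x} (f : A → X) (g : B → X) where

    Pullback : Set (a ⊔ b ⊔ x)
    Pullback = Σ[ y ∈ A ] Σ[ z ∈ B ] f y ≡ g z

    π₁ : Pullback → A
    π₁ = proj₁

    π₂ : Pullback → B
    π₂ = proj₁ ∘ proj₂

    -- A ∗_X B
    Join : Set (a ⊔ b ⊔ x)
    Join = Pushout π₁ π₂

    -- f ∗ g
    join : Join → X
    join = IsPushout.rec (isPushout π₁ π₂) f g (proj₂ ∘ proj₂)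

totalMap : {A : Set a} {X : Set x} (P : X → Set p) (f : A → X) →
           Σ A (P ∘ f) → Σ X P
totalMap P f (y , t) = f y , t

{-# OPTIONS --without-K #-}

-- Three facts about homotopy pushouts give the result.  Flattening: a family over
-- a pushout has the pushout of the total spaces as its total space, here for a
-- family pulled back from X.  The apex of the flattened span, Σ (A ×_X B) (P ∘ f),
-- is equivalent over its two feet to the pullback of the total maps, because a
-- path in Σ X P from (f a , t) is a path e in X together with the endpoint
-- subst P e t.  Finally, pushouts of equivalent spans are equivalent.

module Submission where

open import Defs
open import Data.Product.Base using (Σ; Σ-syntax; _×_; _,_; proj₁; proj₂; uncurry)
open import Data.Product.Properties using (Σ-≡,≡→≡)
open import Function.Base using (_∘_)
open import Function.Bundles using (mk↔ₛ′)
open import Function.Properties.Inverse.HalfAdjointEquivalence using (_≃_; ↔⇒≃)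
open import Level using (Level; _⊔_)
open import Relation.Binary.PropositionalEquality
  using (_≡_; refl; sym; trans; cong; subst; dcong; cong-app; module ≡-Reasoning)
open import Relation.Binary.PropositionalEquality.Properties using (trans-reflʳ)

private
  variable
    a b c p q w x z ℓ : Level

-- Function extensionality with its computation rule.

module _ (ext : FunExt) where

  -- The functions homotopic to h form a retract of the sections of a family of
  -- singletons, hence a contractible type: this upgrades bare extensionality to a
  -- right inverse of cong-app.

  homotopy-induction :
    {A : Set a} {B : A → Set b} {h : (y : A) → B y}
    (C : (k : (y : A) → B y) → (∀ y → h y ≡ k y) → Set c) →
    C h (λ _ → refl) → ∀ k H → C k H
  homotopy-induction {h = h} C base k H =
    subst (λ σ → C (proj₁ ∘ σ) (proj₂ ∘ σ)) (ext (λ y → singleton (H y))) base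
    where
    singleton : ∀ {B : Set b} {y y′ : B} (r : y ≡ y′) → (y , refl) ≡ (y′ , r)
    singleton refl = refl

  cong-app-surjective :
    {A : Set a} {B : A → Set b} {h k : (y : A) → B y} (H : ∀ y → h y ≡ k y) →
    Σ[ r ∈ h ≡ k ] cong-app r ≡ H
  cong-app-surjective =
    homotopy-induction (λ _ H → Σ[ r ∈ _ ] cong-app r ≡ H) (refl , refl) _

  funext : {A : Set a} {B : A → Set b} {h k : (y : A) → B y} →
           (∀ y → h y ≡ k y) → h ≡ k
  funext H = proj₁ (cong-app-surjective H)

  cong-app-funext : {A : Set a} {B : A → Set b} {h k : (y : A) → B y}
                    (H : ∀ y → h y ≡ k y) → cong-app (funext H) ≡ H
  cong-app-funext H = proj₂ (cong-app-surjective H)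

  -- Flattening.

  module _ {W : Set w} {X : Set x} (P : X → Set p) (k : W → X) where

    -- Transport is along `cong k γ` in `P`, not along `γ` in `P ∘ k`, so that a given path in `X`
    -- can later replace `cong k γ`.
    lift : {w₁ w₂ : W} (γ : w₁ ≡ w₂) (t : P (k w₁)) →
           _≡_ {A = Σ W (P ∘ k)} (w₁ , t) (w₂ , subst P (cong k γ) t)
    lift refl t = refl

    module _ (T : Σ W (P ∘ k) → Set q) where

      private
        T̂ : W → Set _
        T̂ y = (t : P (k y)) → T (y , t)

      -- Turns path data for eliminating from the total space into path data over `W`; at `refl` it
      -- is exactly `funext`.
      subst-Π : {w₁ w₂ : W} (γ : w₁ ≡ w₂) {h₁ : T̂ w₁} {h₂ : T̂ w₂} →
                (∀ t → subst T (lift γ t) (h₁ t) ≡ h₂ (subst P (cong k γ) t)) →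
                subst T̂ γ h₁ ≡ h₂
      subst-Π refl = funext

      -- Transfers the path computation rule from `W` to the total space. After path induction it
      -- comes down to `cong-app (funext μ)` being `μ`.
      dcong-uncurry :
        {w₁ w₂ : W} (γ : w₁ ≡ w₂) (h : ∀ y → T̂ y) {h₁ : T̂ w₁} {h₂ : T̂ w₂}
        (μ : ∀ t → subst T (lift γ t) (h₁ t) ≡ h₂ (subst P (cong k γ) t))
        (r₁ : h w₁ ≡ h₁) (r₂ : h w₂ ≡ h₂) →
        dcong h γ ≡
          trans (cong (subst T̂ γ) r₁) (trans (subst-Π γ μ) (sym r₂)) →
        ∀ t → dcong (uncurry h) (lift γ t) ≡
          trans (cong (subst T (lift γ t)) (cong-app r₁ t))
                (trans (μ t) (sym (cong-app r₂ (subst P (cong k γ) t))))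
      dcong-uncurry refl h μ refl refl d t = begin
        refl                       ≡⟨ cong (λ r → cong-app r t) d ⟩
        cong-app (trans (funext μ) refl) t
          ≡⟨ cong (λ r → cong-app r t) (trans-reflʳ (funext μ)) ⟩
        cong-app (funext μ) t      ≡⟨ cong (λ H → H t) (cong-app-funext μ) ⟩
        μ t                        ≡⟨ trans-reflʳ (μ t) ⟨
        trans (μ t) refl           ∎
        where open ≡-Reasoning

  module _ {S : Set c} {A : Set a} {B : Set b} {W : Set w} {X : Set x}
           {u : S → A} {v : S → B} (po : IsPushout u v W)
           (P : X → Set p) (k : W → X) where

    open IsPushout po

    -- By currying, a section of `T` over the total space is a section over `W` of
    -- `∀ t → T (y , t)`, so the rules for `W` supply all those required.
    flattening-strict :
      IsPushout {S = Σ[ s ∈ S ] P (k (inl (u s)))}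
                {A = Σ A (P ∘ k ∘ inl)} {B = Σ B (P ∘ k ∘ inr)}
                (λ (s , t) → u s , t)
                (λ (s , t) → v s , subst P (cong k (glue s)) t)
                (Σ W (P ∘ k))
    flattening-strict = record
      { inl      = λ (y , t) → inl y , t
      ; inr      = λ (z , t) → inr z , t
      ; glue     = λ (s , t) → lift P k (glue s) t
      ; ind      = λ T l r m (y , t) →
          ind _ _ _ (over T l r m) y t
      ; ind-inl  = λ T l r m (y , t) →
          cong-app (ind-inl _ _ _ (over T l r m) y) t
      ; ind-inr  = λ T l r m (z , t) →
          cong-app (ind-inr _ _ _ (over T l r m) z) t
      ; ind-glue = λ T l r m (s , t) →
          dcong-uncurry P k T (glue s) _ {h₂ = λ t′ → r (v s , t′)}
            (λ t′ → m (s , t′))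
            (ind-inl _ _ _ (over T l r m) (u s))
            (ind-inr _ _ _ (over T l r m) (v s))
            (ind-glue _ _ _ (over T l r m) s) t
      }
      where
      over : (T : Σ W (P ∘ k) → Set q)
             (l : ∀ yt → T (inl (proj₁ yt) , proj₂ yt))
             (r : ∀ zt → T (inr (proj₁ zt) , proj₂ zt)) →
             (∀ st → subst T (lift P k (glue (proj₁ st)) (proj₂ st))
                             (l (u (proj₁ st) , proj₂ st)) ≡
                     r (v (proj₁ st) ,
                        subst P (cong k (glue (proj₁ st))) (proj₂ st))) →
             PathOver (λ y → ∀ t → T (y , t))
                      (λ y t → l (y , t)) (λ z t → r (z , t))
      over T l r m s = subst-Π P k T (glue s) (λ t → m (s , t))

    -- The computation rules of k hold only up to _≡_, so the maps f and g that
    -- define k on the feet of the span must be allowed to differ from k ∘ inl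
    -- and k ∘ inr.

    flattening :
      {f : A → X} {g : B → X} {e : ∀ s → f (u s) ≡ g (v s)}
      (k-inl : ∀ y → k (inl y) ≡ f y) (k-inr : ∀ z → k (inr z) ≡ g z) →
      (∀ s → cong k (glue s) ≡
             trans (k-inl (u s)) (trans (e s) (sym (k-inr (v s))))) →
      IsPushout {S = Σ[ s ∈ S ] P (f (u s))} {A = Σ A (P ∘ f)} {B = Σ B (P ∘ g)}
                (λ (s , t) → u s , t)
                (λ (s , t) → v s , subst P (e s) t)
                (Σ W (P ∘ k))
    flattening {e = e} k-inl k-inr k-glue
      -- Matching replaces `f` and `g` by `k ∘ inl` and `k ∘ inr`, and makes both homotopies
      -- constantly `refl`.
      with cong-app-surjective k-inl | cong-app-surjective k-inr
    ... | refl , refl | refl , refl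
      with funext (λ s → trans (k-glue s) (trans-reflʳ (e s)))
    ... | refl = flattening-strict

-- Recursion, uniqueness of maps, and change of apex.

module _ {S : Set c} {A : Set a} {B : Set b} {W : Set w}
         {u : S → A} {v : S → B} (po : IsPushout u v W) where

  open IsPushout po

  module _ {Z : Set z} (l : A → Z) (r : B → Z) (m : ∀ s → l (u s) ≡ r (v s)) where

    rec-inl : ∀ y → rec l r m (inl y) ≡ l y
    rec-inl = ind-inl _ _ _ _

    rec-inr : ∀ y → rec l r m (inr y) ≡ r y
    rec-inr = ind-inr _ _ _ _

    -- `ind-glue` for a constant family mentions `dcong` and `subst-constant`; both disappear by
    -- path induction once the path and its endpoints are generalised.
    rec-glue : ∀ s → cong (rec l r m) (glue s) ≡
                     trans (rec-inl (u s)) (trans (m s) (sym (rec-inr (v s))))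
    rec-glue s = unconjugate (glue s) (rec l r m) (rec-inl (u s)) (rec-inr (v s))
                             (m s) (ind-glue _ _ _ _ s)
      where
      unconjugate :
        {w₁ w₂ : W} (γ : w₁ ≡ w₂) (h : W → Z) {z₁ z₂ : Z}
        (r₁ : h w₁ ≡ z₁) (r₂ : h w₂ ≡ z₂) (μ : z₁ ≡ z₂) →
        dcong h γ ≡ trans (cong (subst (λ _ → Z) γ) r₁)
                          (trans (trans (subst-constant γ) μ) (sym r₂)) →
        cong h γ ≡ trans r₁ (trans μ (sym r₂))
      unconjugate refl h refl refl μ d = d

  -- A path over `γ` in the family `h y ≡ k y` is a commuting square, so `ind` builds the homotopy.
  uniqueness :
    {Z : Set z} (h k : W → Z)
    (on-inl : ∀ y → h (inl y) ≡ k (inl y)) (on-inr : ∀ y → h (inr y) ≡ k (inr y)) →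
    (∀ s → trans (on-inl (u s)) (cong k (glue s)) ≡
           trans (cong h (glue s)) (on-inr (v s))) →
    ∀ y → h y ≡ k y
  uniqueness h k on-inl on-inr square =
    ind (λ y → h y ≡ k y) on-inl on-inr (λ s → over (glue s) (square s))
    where
    over : {w₁ w₂ : W} (γ : w₁ ≡ w₂) {r₁ : h w₁ ≡ k w₁} {r₂ : h w₂ ≡ k w₂} →
           trans r₁ (cong k γ) ≡ trans (cong h γ) r₂ →
           subst (λ y → h y ≡ k y) γ r₁ ≡ r₂
    over refl {r₁} eq = trans (sym (trans-reflʳ r₁)) eq

  -- Path data given at the points `to s` extends to all of `S` along `right-inverse-of`; the path
  -- rule requires the extension to restrict back to `m`.
  precompose-≃ : {S′ : Set ℓ} (φ : S′ ≃ S) →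
                 IsPushout (u ∘ _≃_.to φ) (v ∘ _≃_.to φ) W
  precompose-≃ {S′ = S′} φ = record
    { inl      = inl
    ; inr      = inr
    ; glue     = glue ∘ to
    ; ind      = λ Q l r m → ind Q l r (extend m)
    ; ind-inl  = λ Q l r m → ind-inl Q l r (extend m)
    ; ind-inr  = λ Q l r m → ind-inr Q l r (extend m)
    ; ind-glue = λ Q l r m s →
        trans (ind-glue Q l r (extend m) (to s))
              (cong (λ μ → trans (cong (subst Q _) (ind-inl Q l r (extend m) _))
                                 (trans μ (sym (ind-inr Q l r (extend m) _))))
                    (extend-to {C = λ s′ → subst Q (glue s′) (l (u s′)) ≡ r (v s′)}
                               m s))
    }
    where
    open _≃_ φ

    extend : {C : S → Set q} → (∀ s → C (to s)) → ∀ s → C s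
    extend {C = C} m s = subst C (right-inverse-of s) (m (from s))

    subst-cong-to : (C : S → Set q) (m : ∀ s → C (to s)) {s₁ s₂ : S′} (r : s₁ ≡ s₂) →
                    subst C (cong to r) (m s₁) ≡ m s₂
    subst-cong-to C m refl = refl

    extend-to : {C : S → Set q} (m : ∀ s → C (to s)) → ∀ s → extend {C = C} m (to s) ≡ m s
    extend-to {C = C} m s =
      -- The half-adjoint coherence replaces `right-inverse-of (to s)` by
      -- `cong to (left-inverse-of s)`.
      trans (cong (λ r → subst C r (m (from (to s)))) (sym (left-right s)))
            (subst-cong-to C m (left-inverse-of s))

-- Uniqueness of pushouts.

module _ {S : Set c} {A : Set a} {B : Set b} {u : S → A} {v : S → B} where

  module _ {W : Set w} {W′ : Set z} (po : IsPushout u v W) (po′ : IsPushout u v W′) where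

    private
      module W  = IsPushout po
      module W′ = IsPushout po′

    comparison : W → W′
    comparison = W.rec W′.inl W′.inr W′.glue

  -- The round trip respects the point constructors and `glue`, as the identity does. Exchanging the
  -- two pushouts gives the other composite.
  comparison-inverse :
    {W : Set w} {W′ : Set z} (po : IsPushout u v W) (po′ : IsPushout u v W′) →
    ∀ y → comparison po′ po (comparison po po′ y) ≡ y
  comparison-inverse {W = W} {W′} po po′ =
    uniqueness po (back ∘ there) (λ y → y)
      (λ y → trans (cong back (there-inl y)) (back-inl y))
      (λ y → trans (cong back (there-inr y)) (back-inr y))
      (λ s → square (W.glue s) (W′.glue s)
                    (there-inl (u s)) (there-inr (v s))
                    (back-inl (u s)) (back-inr (v s))
                    (rec-glue po _ _ _ s) (rec-glue po′ _ _ _ s))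
    where
    module W  = IsPushout po
    module W′ = IsPushout po′
    there     = comparison po po′
    back      = comparison po′ po
    there-inl = rec-inl po W′.inl W′.inr W′.glue
    there-inr = rec-inr po W′.inl W′.inr W′.glue
    back-inl  = rec-inl po′ W.inl W.inr W.glue
    back-inr  = rec-inr po′ W.inl W.inr W.glue

    trans-sym-cancel : {y y′ : W} (r r′ : y ≡ y′) → refl ≡ trans r (sym r′) → r ≡ r′
    trans-sym-cancel r refl eq = sym (trans eq (trans-reflʳ r))

    square :
      {w₁ w₂ : W} (γ : w₁ ≡ w₂) {x₁ x₂ : W′} (γ′ : x₁ ≡ x₂)
      (p₁ : there w₁ ≡ x₁) (p₂ : there w₂ ≡ x₂)
      (q₁ : back x₁ ≡ w₁) (q₂ : back x₂ ≡ w₂) →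
      cong there γ ≡ trans p₁ (trans γ′ (sym p₂)) →
      cong back γ′ ≡ trans q₁ (trans γ (sym q₂)) →
      trans (trans (cong back p₁) q₁) (cong (λ y → y) γ) ≡
      trans (cong (back ∘ there) γ) (trans (cong back p₂) q₂)
    square refl γ′ refl refl q₁ q₂ there-γ back-γ′ =
      -- `γ′` is now a loop, which cannot be matched with `refl` without K; `there-γ` shows it
      -- trivial, and `back-γ′` then yields `q₁ ≡ q₂`.
      trans (trans-reflʳ q₁)
            (trans-sym-cancel q₁ q₂
              (trans (cong (cong back) (trans there-γ (trans-reflʳ γ′))) back-γ′))

  pushout-unique : {W : Set w} {W′ : Set z} →
                   IsPushout u v W → IsPushout u v W′ → W ≃ W′
  pushout-unique po po′ =
    ↔⇒≃ (mk↔ₛ′ (comparison po po′) (comparison po′ po)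
               (comparison-inverse po′ po) (comparison-inverse po po′))

-- Joins and total spaces.

module _ (po : Pushouts) {A : Set a} {B : Set b} {X : Set x}
         (f : A → X) (g : B → X) (P : X → Set p) where

  -- The forward map is chosen so that its composites with the two projections are definitionally
  -- the legs of the flattened span.
  pullback-total :
    (Σ[ (y , z , e) ∈ Pullback po f g ] P (f y)) ≃
    Pullback po (totalMap P f) (totalMap P g)
  pullback-total = ↔⇒≃ (mk↔ₛ′
    (λ ((y , z , e) , t) → (y , t) , (z , subst P e t) , Σ-≡,≡→≡ (e , refl))
    (λ ((y , t) , (z , t′) , r) → (y , z , cong proj₁ r) , t)
    (λ ((y , t) , (z , t′) , r) →
      cong (λ (t″ , r′) → (y , t) , (z , t″) , r′) (straighten r))
    (λ ((y , z , e) , t) → cong (λ e′ → (y , z , e′) , t) (cong-proj₁ e)))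
    where
    cong-proj₁ : {x₁ x₂ : X} (e : x₁ ≡ x₂) {t : P x₁} →
                 cong proj₁ (Σ-≡,≡→≡ {B = P} {p₁ = x₁ , t} (e , refl)) ≡ e
    cong-proj₁ refl = refl

    -- The endpoint of `r` changes, so `r` is compared together with `t₂`; path induction then
    -- applies.
    straighten :
      {x₁ x₂ : X} {t₁ : P x₁} {t₂ : P x₂} (r : (x₁ , t₁) ≡ (x₂ , t₂)) →
      _≡_ {A = Σ[ t ∈ P x₂ ] (x₁ , t₁) ≡ (x₂ , t)}
          (subst P (cong proj₁ r) t₁ , Σ-≡,≡→≡ (cong proj₁ r , refl)) (t₂ , r)
    straighten refl = refl

theorem7p3 : (po : Pushouts) → FunExt →
    ∀ {a b x p} {A : Set a} {B : Set b} {X : Set x}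
    (f : A → X) (g : B → X) (P : X → Set p) →
    let L = Σ (Join po f g) (P ∘ join po f g)
        R = Join po (totalMap P f) (totalMap P g)
    in (L ≃ R) × (Univalence (a ⊔ b ⊔ x ⊔ p) → L ≡ R)
theorem7p3 po ext f g P = L≃R , λ ua → _≃_.from (proj₁ (ua _ _)) L≃R
  where
  open Pushouts po

  J = isPushout (π₁ po f g) (π₂ po f g)

  L≃R : Σ (Join po f g) (P ∘ join po f g) ≃ Join po (totalMap P f) (totalMap P g)
  L≃R = pushout-unique
    (flattening ext J P (join po f g)
      (rec-inl J _ _ _) (rec-inr J _ _ _) (rec-glue J _ _ _))
    (precompose-≃ (isPushout _ _) (pullback-total po f g P))
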